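{- For any upset $\alpha$ and any argument $\Gamma \rhd \Delta$: the argument $\Gamma \rhd \Delta$ is $\alpha$-materially valid if and only if it is classically valid.
   Context: Language: $\mathcal{L}$ is the propositional language with countably infinitely many atomic sentences and connectives $\neg,\lor$; the connectives $\land,\bot,\top,\supset$ (material conditional) are defined from $\neg,\lor$ as usual, with $\bigwedge\emptyset=\top$ and $\bigvee\emptyset=\bot$. An argument $\Gamma\rhd\Delta$ is a pair of finite (possibly empty) sets $\Gamma,\Delta$ of sentences of $\mathcal{L}$. A probabilistic model is $\langle W,\mathcal{A},[\![\cdot]\!],P\rangle$ where $W$ is a nonempty set (of worlds); $\mathcal{A}\subseteq\mathcal{P}(W)$ contains $\emptyset$ and is closed under complement in $W$ and binary union; $[\![\cdot]\!]:\mathcal{L}\to\mathcal{A}$ satisfies $[\![\neg\phi]\!]=W\setminus[\![\phi]\!]$ and $[\![\phi\lor\psi]\!]=[\![\phi]\!]\cup[\![\psi]\!]$; and $P:\mathcal{A}\to[0,1]$ is a finitely additive probability ($P(\emptyset)=0$, $P(W\setminus A)=1-P(A)$, and $P(A\cup B)=P(A)+P(B)$ for disjoint $A,B\in\mathcal{A}$). Write $P(\phi)$ for $P([\![\phi]\!])$. An upset is a set $\alpha\subseteq[0,1]$ with $1\in\alpha$, $0\notin\alpha$, and such that $x\in\alpha$, $x\le y\le 1$ imply $y\in\alpha$. The argument $\Gamma\rhd\Delta$ is $\alpha$-materially valid iff every probabilistic model satisfies $P(\bigwedge\Gamma\supset\bigvee\Delta)\in\alpha$. It is classically valid iff for every probabilistic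 model and every world $w\in W$, if $w\in[\![\gamma]\!]$ for every $\gamma\in\Gamma$, then $w\in[\![\delta]\!]$ for some $\delta\in\Delta$. -}

module Defs where

open import Level using (Level; suc)
open import Data.List using (List; foldr)
open import Data.List.Relation.Unary.All using (All)
open import Data.List.Relation.Unary.Any using (Any)
open import Data.Nat using (ℕ; _⊔_)
import Data.Nat as ℕ
import Data.Nat.Properties as ℕ
open import Data.Product using (_×_; _,_; ∃-syntax)
open import Data.Rational using (ℚ; 0ℚ; 1ℚ; ½; ∣_∣)
import Data.Rational as ℚ
import Data.Rational.Properties as ℚ
open import Data.Rational.Solver using (module +-*-Solver)
open import Relation.Binary.PropositionalEquality using (_≡_; refl; sym; trans; cong)
open import Relation.Unary using (Pred; _∈_; _∉_; _∪_; ∁; _≐_)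
  renaming (_⊥_ to Disjoint)
open import Relation.Unary.Polymorphic using (∅)

-- ℝ is the setoid of Cauchy sequences of rationals.  Given excluded middle,
-- every Dedekind cut is the limit of such a sequence, without any choice.

record ℝ : Set where
  field
    seq    : ℕ → ℚ
    cauchy : ∀ ε → 0ℚ ℚ.< ε →
             ∃[ N ] (∀ m n → N ℕ.≤ m → N ℕ.≤ n → ∣ seq m ℚ.- seq n ∣ ℚ.< ε)

open ℝ public

infix  4 _≤_ _≈_
infixl 6 _+_ _-_

_≤_ : ℝ → ℝ → Set
x ≤ y = ∀ ε → 0ℚ ℚ.< ε → ∃[ N ] (∀ n → N ℕ.≤ n → seq x n ℚ.≤ seq y n ℚ.+ ε)

_≈_ : ℝ → ℝ → Set
x ≈ y = x ≤ y × y ≤ x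

private
  halves : ∀ ε → ½ ℚ.* ε ℚ.+ ½ ℚ.* ε ≡ ε
  halves ε = trans (sym (ℚ.*-distribʳ-+ ε ½ ½)) (ℚ.*-identityˡ ε)

  half-pos : ∀ {ε} → 0ℚ ℚ.< ε → 0ℚ ℚ.< ½ ℚ.* ε
  half-pos {ε} = ℚ.*-monoʳ-<-pos ½ {0ℚ} {ε}

  +-rearrange : ∀ a b c d → (a ℚ.+ b) ℚ.- (c ℚ.+ d) ≡ (a ℚ.- c) ℚ.+ (b ℚ.- d)
  +-rearrange = solve 4 (λ a b c d →
    (a :+ b) :- (c :+ d) := (a :- c) :+ (b :- d)) refl
    where open +-*-Solver

  neg-rearrange : ∀ a b → ℚ.- a ℚ.- ℚ.- b ≡ ℚ.- (a ℚ.- b)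
  neg-rearrange = solve 2 (λ a b → :- a :- (:- b) := :- (a :- b)) refl
    where open +-*-Solver

fromℚ : ℚ → ℝ
fromℚ q .seq    _       = q
fromℚ q .cauchy ε 0<ε = 0 , λ _ _ _ _ → begin-strict
  ∣ q ℚ.- q ∣ ≡⟨ cong ∣_∣ (ℚ.+-inverseʳ q) ⟩
  0ℚ          <⟨ 0<ε ⟩
  ε           ∎
  where open ℚ.≤-Reasoning

0ℝ 1ℝ : ℝ
0ℝ = fromℚ 0ℚ
1ℝ = fromℚ 1ℚ

_+_ : ℝ → ℝ → ℝ
(x + y) .seq n = seq x n ℚ.+ seq y n
(x + y) .cauchy ε 0<ε
  with cauchy x (½ ℚ.* ε) (half-pos 0<ε) | cauchy y (½ ℚ.* ε) (half-pos 0<ε)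
... | M , p | N , q = M ⊔ N , λ m n M⊔N≤m M⊔N≤n → begin-strict
  ∣ (seq x m ℚ.+ seq y m) ℚ.- (seq x n ℚ.+ seq y n) ∣
    ≡⟨ cong ∣_∣ (+-rearrange (seq x m) (seq y m) (seq x n) (seq y n)) ⟩
  ∣ (seq x m ℚ.- seq x n) ℚ.+ (seq y m ℚ.- seq y n) ∣
    ≤⟨ ℚ.∣p+q∣≤∣p∣+∣q∣ (seq x m ℚ.- seq x n) (seq y m ℚ.- seq y n) ⟩
  ∣ seq x m ℚ.- seq x n ∣ ℚ.+ ∣ seq y m ℚ.- seq y n ∣
    <⟨ ℚ.+-mono-< (p m n (ℕ.m⊔n≤o⇒m≤o M N M⊔N≤m) (ℕ.m⊔n≤o⇒m≤o M N M⊔N≤n))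
                  (q m n (ℕ.m⊔n≤o⇒n≤o M N M⊔N≤m) (ℕ.m⊔n≤o⇒n≤o M N M⊔N≤n)) ⟩
  ½ ℚ.* ε ℚ.+ ½ ℚ.* ε
    ≡⟨ halves ε ⟩
  ε ∎
  where open ℚ.≤-Reasoning

-_ : ℝ → ℝ
(- x) .seq n = ℚ.- seq x n
(- x) .cauchy ε 0<ε with cauchy x ε 0<ε
... | N , p = N , λ m n N≤m N≤n → begin-strict
  ∣ ℚ.- seq x m ℚ.- ℚ.- seq x n ∣ ≡⟨ cong ∣_∣ (neg-rearrange (seq x m) (seq x n)) ⟩
  ∣ ℚ.- (seq x m ℚ.- seq x n) ∣   ≡⟨ ℚ.∣-p∣≡∣p∣ (seq x m ℚ.- seq x n) ⟩
  ∣ seq x m ℚ.- seq x n ∣         <⟨ p m n N≤m N≤n ⟩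
  ε                               ∎
  where open ℚ.≤-Reasoning

_-_ : ℝ → ℝ → ℝ
x - y = x + (- y)

[0,1] : Pred ℝ _
[0,1] x = 0ℝ ≤ x × x ≤ 1ℝ

-- Since x ≈ y implies x ≤ y, membership in an upset respects _≈_.

record Upset (ℓ : Level) : Set (suc ℓ) where
  field
    α        : Pred ℝ ℓ
    α⊆[0,1]  : ∀ {x} → x ∈ α → x ∈ [0,1]
    1∈α      : 1ℝ ∈ α
    0∉α      : 0ℝ ∉ α
    upward   : ∀ {x y} → x ∈ α → x ≤ y → y ≤ 1ℝ → y ∈ α

infix  8 ¬_
infixr 7 _∧_
infixr 6 _∨_
infixr 5 _⊃_

data Sentence : Set where
  atom : ℕ → Sentence
  ¬_   : Sentence → Sentence
  _∨_  : Sentence → Sentence → Sentence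

_∧_ _⊃_ : Sentence → Sentence → Sentence
φ ∧ ψ = ¬ (¬ φ ∨ ¬ ψ)
φ ⊃ ψ = ¬ φ ∨ ψ

⊤ ⊥ : Sentence
⊤ = atom 0 ∨ ¬ atom 0
⊥ = ¬ ⊤

-- A finite set of sentences is given by a list enumerating it, in any order
-- and possibly with repetitions.

⋀ ⋁ : List Sentence → Sentence
⋀ = foldr _∧_ ⊤
⋁ = foldr _∨_ ⊥

infix 4 _▷_

record Argument : Set where
  constructor _▷_
  field
    premises    : List Sentence
    conclusions : List Sentence

-- Sets of worlds are predicates, with _≐_ (mutual inclusion) as equality;
-- hence 𝒜-resp-≐ and P-cong.  The latter also makes P independent of the
-- proof that its argument is in 𝒜.

record ProbabilisticModel (ℓ : Level) : Set (suc ℓ) where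
  field
    W        : Set ℓ
    nonempty : W

    𝒜        : Pred (Pred W ℓ) ℓ
    𝒜-resp-≐ : ∀ {A B} → A ≐ B → A ∈ 𝒜 → B ∈ 𝒜
    ∅∈𝒜      : ∅ ∈ 𝒜
    ∁∈𝒜      : ∀ {A} → A ∈ 𝒜 → ∁ A ∈ 𝒜
    ∪∈𝒜      : ∀ {A B} → A ∈ 𝒜 → B ∈ 𝒜 → A ∪ B ∈ 𝒜

    ⟦_⟧      : Sentence → Pred W ℓ
    ⟦_⟧∈𝒜    : ∀ φ → ⟦ φ ⟧ ∈ 𝒜
    ⟦¬⟧      : ∀ φ → ⟦ ¬ φ ⟧ ≐ ∁ ⟦ φ ⟧
    ⟦∨⟧      : ∀ φ ψ → ⟦ φ ∨ ψ ⟧ ≐ ⟦ φ ⟧ ∪ ⟦ ψ ⟧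

    P        : ∀ A → A ∈ 𝒜 → ℝ
    P-cong   : ∀ {A B} (A∈𝒜 : A ∈ 𝒜) (B∈𝒜 : B ∈ 𝒜) → A ≐ B → P A A∈𝒜 ≈ P B B∈𝒜
    P∈[0,1]  : ∀ {A} (A∈𝒜 : A ∈ 𝒜) → P A A∈𝒜 ∈ [0,1]
    P-∅      : P ∅ ∅∈𝒜 ≈ 0ℝ
    P-∁      : ∀ {A} (A∈𝒜 : A ∈ 𝒜) → P (∁ A) (∁∈𝒜 A∈𝒜) ≈ 1ℝ - P A A∈𝒜
    P-∪      : ∀ {A B} (A∈𝒜 : A ∈ 𝒜) (B∈𝒜 : B ∈ 𝒜) → Disjoint A B →
               P (A ∪ B) (∪∈𝒜 A∈𝒜 B∈𝒜) ≈ P A A∈𝒜 + P B B∈𝒜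

  Pr : Sentence → ℝ
  Pr φ = P ⟦ φ ⟧ ⟦ φ ⟧∈𝒜

MateriallyValid : ∀ {ℓ} → Upset ℓ → Argument → Set (suc ℓ)
MateriallyValid {ℓ} U (Γ ▷ Δ) =
  ∀ (M : ProbabilisticModel ℓ) → let open ProbabilisticModel M in
  Pr (⋀ Γ ⊃ ⋁ Δ) ∈ Upset.α U

ClassicallyValid : ∀ ℓ → Argument → Set (suc ℓ)
ClassicallyValid ℓ (Γ ▷ Δ) =
  ∀ (M : ProbabilisticModel ℓ) → let open ProbabilisticModel M in
  ∀ (w : W) → All (λ γ → w ∈ ⟦ γ ⟧) Γ → Any (λ δ → w ∈ ⟦ δ ⟧) Δ

{-# OPTIONS --safe #-}
-- The material conditional ⋀ Γ ⊃ ⋁ Δ is true at a world iff that world is not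
-- a counterexample to Γ ▷ Δ.  So classical validity makes it the sure event, of
-- probability 1 ∈ α.  Conversely, replace the probability of a model by the
-- point mass at a world w: the conditional then has probability 0 ∉ α unless it
-- is true at w.
module Submission where

open import Defs
open import Axiom.ExcludedMiddle using (ExcludedMiddle)
open import Data.List using ([]; _∷_)
open import Data.List.Relation.Unary.All using (All; []; _∷_)
open import Data.List.Relation.Unary.Any using (Any; here; there)
open import Data.Product using (_×_; _,_; proj₁; proj₂)
open import Data.Rational using (0ℚ; 1ℚ)
import Data.Rational as ℚ
import Data.Rational.Properties as ℚ
open import Data.Rational.Solver using (module +-*-Solver)
open import Data.Sum using (_⊎_; inj₁; inj₂; [_,_]′)
open import Function.Base using (_∘_)
open import Function.Bundles using (_⇔_; mk⇔)
open import Level using (Level; lower)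
open import Relation.Binary.PropositionalEquality using (_≡_; refl; sym)
open import Relation.Nullary using (Dec; yes; no; contradiction)
  renaming (¬_ to Not)
open import Relation.Unary using (_∈_; ∁; _≐_)
open import Relation.Unary.Polymorphic using (∅)

private variable
  a b ℓ : Level
  A : Set a
  B : Set b

seq-≤⇒≤ : ∀ x y → (∀ n → seq x n ℚ.≤ seq y n) → x ≤ y
seq-≤⇒≤ x y x≤y ε 0<ε = 0 , λ n _ → begin
  seq x n          ≤⟨ x≤y n ⟩
  seq y n          ≡⟨ ℚ.+-identityʳ (seq y n) ⟨
  seq y n ℚ.+ 0ℚ   ≤⟨ ℚ.+-monoʳ-≤ (seq y n) (ℚ.<⇒≤ 0<ε) ⟩
  seq y n ℚ.+ ε    ∎
  where open ℚ.≤-Reasoning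

seq-≡⇒≈ : ∀ x y → (∀ n → seq x n ≡ seq y n) → x ≈ y
seq-≡⇒≈ x y x≡y =
  seq-≤⇒≤ x y (ℚ.≤-reflexive ∘ x≡y) ,
  seq-≤⇒≤ y x (ℚ.≤-reflexive ∘ sym ∘ x≡y)

≤-refl : ∀ x → x ≤ x
≤-refl x = seq-≤⇒≤ x x (λ _ → ℚ.≤-refl)

0≤1 : 0ℝ ≤ 1ℝ
0≤1 = seq-≤⇒≤ 0ℝ 1ℝ (λ _ → ℚ.nonNegative⁻¹ 1ℚ)

-- Adding `z - x - y` to both sides of `x ≤ y` gives the claim, so for each `ε` the same `N` serves.
-‿antimonoʳ-≤ : ∀ x y z → x ≤ y → z - y ≤ z - x
-‿antimonoʳ-≤ x y z x≤y ε 0<ε with x≤y ε 0<ε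
... | N , p = N , λ n N≤n → begin
  seq z n ℚ.- seq y n
    ≡⟨ insert (seq x n) (seq y n) (seq z n) ⟩
  (seq z n ℚ.- seq x n ℚ.- seq y n) ℚ.+ seq x n
    ≤⟨ ℚ.+-monoʳ-≤ (seq z n ℚ.- seq x n ℚ.- seq y n) (p n N≤n) ⟩
  (seq z n ℚ.- seq x n ℚ.- seq y n) ℚ.+ (seq y n ℚ.+ ε)
    ≡⟨ cancel (seq x n) (seq y n) (seq z n) ε ⟩
  seq z n ℚ.- seq x n ℚ.+ ε ∎
  where
  open ℚ.≤-Reasoning
  open +-*-Solver
  insert : ∀ x y z → z ℚ.- y ≡ (z ℚ.- x ℚ.- y) ℚ.+ x
  insert = solve 3 (λ x y z → z :- y := (z :- x :- y) :+ x) refl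
  cancel : ∀ x y z ε → (z ℚ.- x ℚ.- y) ℚ.+ (y ℚ.+ ε) ≡ z ℚ.- x ℚ.+ ε
  cancel = solve 4 (λ x y z ε → (z :- x :- y) :+ (y :+ ε) := z :- x :+ ε) refl

-- The decision is an argument because excluded middle is opaque: the decisions of `A` and `Not A`,
-- say, come from separate calls, and the lemmas below reconcile them by cases.
indicator : Dec A → ℝ
indicator (yes _) = 1ℝ
indicator (no _)  = 0ℝ

indicator-∈[0,1] : (A? : Dec A) → indicator A? ∈ [0,1]
indicator-∈[0,1] (yes _) = 0≤1 , ≤-refl 1ℝ
indicator-∈[0,1] (no _)  = ≤-refl 0ℝ , 0≤1

indicator-mono : (A? : Dec A) (B? : Dec B) → (A → B) → indicator A? ≤ indicator B?
indicator-mono (yes x) (no ¬y) f = contradiction (f x) ¬y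
-- With the contradictory case gone, one side is extremal, and the bounds 0 and 1 suffice.
indicator-mono A?      (yes _) f = proj₂ (indicator-∈[0,1] A?)
indicator-mono (no _)  B?      f = proj₁ (indicator-∈[0,1] B?)

indicator-false : (A? : Dec A) → Not A → indicator A? ≈ 0ℝ
indicator-false (yes x) ¬x = contradiction x ¬x
indicator-false (no _)  ¬x = ≤-refl 0ℝ , ≤-refl 0ℝ

indicator-¬ : (¬A? : Dec (Not A)) (A? : Dec A) → indicator ¬A? ≈ 1ℝ - indicator A?
indicator-¬ (yes ¬x) (yes x) = contradiction x ¬x
indicator-¬ (yes _)  (no _)  = seq-≡⇒≈ 1ℝ (1ℝ - 0ℝ) (λ _ → refl)
indicator-¬ (no _)   (yes _) = seq-≡⇒≈ 0ℝ (1ℝ - 1ℝ) (λ _ → refl)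
indicator-¬ (no ¬¬x) (no ¬x) = contradiction ¬x ¬¬x

indicator-⊎ : (A⊎B? : Dec (A ⊎ B)) (A? : Dec A) (B? : Dec B) → Not (A × B) →
              indicator A⊎B? ≈ indicator A? + indicator B?
indicator-⊎ _       (yes x) (yes y) ¬xy = contradiction (x , y) ¬xy
indicator-⊎ (yes _) (yes _) (no _)  ¬xy = seq-≡⇒≈ 1ℝ (1ℝ + 0ℝ) (λ _ → refl)
indicator-⊎ (yes _) (no _)  (yes _) ¬xy = seq-≡⇒≈ 1ℝ (0ℝ + 1ℝ) (λ _ → refl)
indicator-⊎ (yes z) (no ¬x) (no ¬y) ¬xy = contradiction z [ ¬x , ¬y ]′
indicator-⊎ (no ¬z) (yes x) (no _)  ¬xy = contradiction (inj₁ x) ¬z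
indicator-⊎ (no ¬z) (no _)  (yes y) ¬xy = contradiction (inj₂ y) ¬z
indicator-⊎ (no _)  (no _)  (no _)  ¬xy = seq-≡⇒≈ 0ℝ (0ℝ + 0ℝ) (λ _ → refl)

-- Every upset contains 1 and omits 0, so on two-valued probabilities all upsets agree.
indicator∈upset⇒true : (U : Upset ℓ) (A? : Dec A) → indicator A? ∈ Upset.α U → A
indicator∈upset⇒true U (yes x) _   = x
indicator∈upset⇒true U (no _)  0∈α = contradiction 0∈α (Upset.0∉α U)

module _ (M : ProbabilisticModel ℓ) where
  open ProbabilisticModel M

  module _ (U : Upset ℓ) where
    open Upset U

    -- The whole space is reached as `∁ ∅`. Membership in `α` travels from `1ℝ` through `1ℝ - P∅`
    -- and the probability of `∁ ∅` to `Pr φ`; each move uses `upward` with one half of an `≈`.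
    sure⇒Pr∈α : ∀ φ → (∀ w → w ∈ ⟦ φ ⟧) → Pr φ ∈ α
    sure⇒Pr∈α φ sure = upward P∁∅∈α (proj₁ (P-cong _ _ ∁∅≐φ)) (proj₂ (P∈[0,1] _))
      where
      ∁∅≐φ : ∁ ∅ ≐ ⟦ φ ⟧
      ∁∅≐φ = (λ {w} _ → sure w) , λ _ → lower

      P∅ : ℝ
      P∅ = P ∅ ∅∈𝒜

      1-P∅∈α : (1ℝ - P∅) ∈ α
      1-P∅∈α = upward 1∈α
        -- `1ℝ - 0ℝ` passes for `1ℝ` here and in the next line: `_≤_` inspects only the sequences,
        -- and both reduce to `1ℚ` termwise.
        (-‿antimonoʳ-≤ P∅ 0ℝ 1ℝ (proj₁ P-∅))
        (-‿antimonoʳ-≤ 0ℝ P∅ 1ℝ (proj₁ (P∈[0,1] ∅∈𝒜)))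

      P∁∅∈α : P (∁ ∅) (∁∈𝒜 ∅∈𝒜) ∈ α
      P∁∅∈α = upward 1-P∅∈α (proj₂ (P-∁ ∅∈𝒜)) (proj₂ (P∈[0,1] _))

  module _ {w : W} where

    ∈⟦¬⟧⁺ : ∀ φ → Not (w ∈ ⟦ φ ⟧) → w ∈ ⟦ ¬ φ ⟧
    ∈⟦¬⟧⁺ φ = proj₂ (⟦¬⟧ φ)

    ∈⟦¬⟧⁻ : ∀ φ → w ∈ ⟦ ¬ φ ⟧ → Not (w ∈ ⟦ φ ⟧)
    ∈⟦¬⟧⁻ φ = proj₁ (⟦¬⟧ φ)

    ∈⟦∨⟧⁺ : ∀ φ ψ → w ∈ ⟦ φ ⟧ ⊎ w ∈ ⟦ ψ ⟧ → w ∈ ⟦ φ ∨ ψ ⟧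
    ∈⟦∨⟧⁺ φ ψ = proj₂ (⟦∨⟧ φ ψ)

    ∈⟦∨⟧⁻ : ∀ φ ψ → w ∈ ⟦ φ ∨ ψ ⟧ → w ∈ ⟦ φ ⟧ ⊎ w ∈ ⟦ ψ ⟧
    ∈⟦∨⟧⁻ φ ψ = proj₁ (⟦∨⟧ φ ψ)

    ∈⟦∧⟧⁺ : ∀ φ ψ → w ∈ ⟦ φ ⟧ → w ∈ ⟦ ψ ⟧ → w ∈ ⟦ φ ∧ ψ ⟧
    ∈⟦∧⟧⁺ φ ψ w∈φ w∈ψ = ∈⟦¬⟧⁺ (¬ φ ∨ ¬ ψ) λ w∈¬φ∨¬ψ →
      [ (λ w∈¬φ → ∈⟦¬⟧⁻ φ w∈¬φ w∈φ) , (λ w∈¬ψ → ∈⟦¬⟧⁻ ψ w∈¬ψ w∈ψ) ]′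
        (∈⟦∨⟧⁻ (¬ φ) (¬ ψ) w∈¬φ∨¬ψ)

    ∈⟦⋁⟧⁺ : ∀ {Δ} → Any (λ δ → w ∈ ⟦ δ ⟧) Δ → w ∈ ⟦ ⋁ Δ ⟧
    ∈⟦⋁⟧⁺ {δ ∷ Δ} (here w∈δ)  = ∈⟦∨⟧⁺ δ (⋁ Δ) (inj₁ w∈δ)
    ∈⟦⋁⟧⁺ {δ ∷ Δ} (there w∈Δ) = ∈⟦∨⟧⁺ δ (⋁ Δ) (inj₂ (∈⟦⋁⟧⁺ w∈Δ))

  module _ (em : ExcludedMiddle ℓ) where

    -- Only `P` changes, so truth of sentences at worlds is definitionally that of `M`. Excluded
    -- middle decides whether `w` lies in an arbitrary event.
    pointMass : W → ProbabilisticModel ℓ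
    pointMass w = record
      { W        = W
      ; nonempty = nonempty
      ; 𝒜        = 𝒜
      ; 𝒜-resp-≐ = 𝒜-resp-≐
      ; ∅∈𝒜      = ∅∈𝒜
      ; ∁∈𝒜      = ∁∈𝒜
      ; ∪∈𝒜      = ∪∈𝒜
      ; ⟦_⟧      = ⟦_⟧
      ; ⟦_⟧∈𝒜    = ⟦_⟧∈𝒜
      ; ⟦¬⟧      = ⟦¬⟧
      ; ⟦∨⟧      = ⟦∨⟧
      ; P        = λ X _ → indicator (em {w ∈ X})
      ; P-cong   = λ _ _ (X⊆Y , Y⊆X) → indicator-mono em em X⊆Y , indicator-mono em em Y⊆X
      ; P∈[0,1]  = λ _ → indicator-∈[0,1] em
      ; P-∅      = indicator-false em lower
      ; P-∁      = λ _ → indicator-¬ em em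
      ; P-∪      = λ _ _ X⊥Y → indicator-⊎ em em em X⊥Y
      }

    module _ {w : W} where

      ∈⟦¬⟧-stable : ∀ φ → Not (w ∈ ⟦ ¬ φ ⟧) → w ∈ ⟦ φ ⟧
      ∈⟦¬⟧-stable φ ¬¬φ with em {w ∈ ⟦ φ ⟧}
      ... | yes w∈φ = w∈φ
      ... | no  w∉φ = contradiction (∈⟦¬⟧⁺ φ w∉φ) ¬¬φ

      -- A conjunction is a negated disjunction of negations, so it yields each conjunct only doubly
      -- negated; stability removes the negations.
      ∈⟦∧⟧⁻ : ∀ φ ψ → w ∈ ⟦ φ ∧ ψ ⟧ → w ∈ ⟦ φ ⟧ × w ∈ ⟦ ψ ⟧
      ∈⟦∧⟧⁻ φ ψ w∈φ∧ψ =
        ∈⟦¬⟧-stable φ (¬φ∨¬ψ-false ∘ inj₁) , ∈⟦¬⟧-stable ψ (¬φ∨¬ψ-false ∘ inj₂)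
        where
        ¬φ∨¬ψ-false = ∈⟦¬⟧⁻ (¬ φ ∨ ¬ ψ) w∈φ∧ψ ∘ ∈⟦∨⟧⁺ (¬ φ) (¬ ψ)

      ∈⟦⊃⟧⁺ : ∀ φ ψ → (w ∈ ⟦ φ ⟧ → w ∈ ⟦ ψ ⟧) → w ∈ ⟦ φ ⊃ ψ ⟧
      ∈⟦⊃⟧⁺ φ ψ f with em {w ∈ ⟦ φ ⟧}
      ... | yes w∈φ = ∈⟦∨⟧⁺ (¬ φ) ψ (inj₂ (f w∈φ))
      ... | no  w∉φ = ∈⟦∨⟧⁺ (¬ φ) ψ (inj₁ (∈⟦¬⟧⁺ φ w∉φ))

      ∈⟦⊃⟧⁻ : ∀ φ ψ → w ∈ ⟦ φ ⊃ ψ ⟧ → w ∈ ⟦ φ ⟧ → w ∈ ⟦ ψ ⟧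
      ∈⟦⊃⟧⁻ φ ψ w∈φ⊃ψ w∈φ with ∈⟦∨⟧⁻ (¬ φ) ψ w∈φ⊃ψ
      ... | inj₁ w∈¬φ = contradiction w∈φ (∈⟦¬⟧⁻ φ w∈¬φ)
      ... | inj₂ w∈ψ  = w∈ψ

      ∈⟦⊤⟧ : w ∈ ⟦ ⊤ ⟧
      ∈⟦⊤⟧ with em {w ∈ ⟦ atom 0 ⟧}
      ... | yes w∈p = ∈⟦∨⟧⁺ (atom 0) (¬ atom 0) (inj₁ w∈p)
      ... | no  w∉p = ∈⟦∨⟧⁺ (atom 0) (¬ atom 0) (inj₂ (∈⟦¬⟧⁺ (atom 0) w∉p))

      ∈⟦⋀⟧⁺ : ∀ {Γ} → All (λ γ → w ∈ ⟦ γ ⟧) Γ → w ∈ ⟦ ⋀ Γ ⟧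
      ∈⟦⋀⟧⁺ []                  = ∈⟦⊤⟧
      ∈⟦⋀⟧⁺ {γ ∷ Γ} (w∈γ ∷ w∈Γ) = ∈⟦∧⟧⁺ γ (⋀ Γ) w∈γ (∈⟦⋀⟧⁺ w∈Γ)

      ∈⟦⋀⟧⁻ : ∀ Γ → w ∈ ⟦ ⋀ Γ ⟧ → All (λ γ → w ∈ ⟦ γ ⟧) Γ
      ∈⟦⋀⟧⁻ []      _   = []
      ∈⟦⋀⟧⁻ (γ ∷ Γ) w∈⋀ with ∈⟦∧⟧⁻ γ (⋀ Γ) w∈⋀
      ... | w∈γ , w∈⋀Γ = w∈γ ∷ ∈⟦⋀⟧⁻ Γ w∈⋀Γ

      ∈⟦⋁⟧⁻ : ∀ Δ → w ∈ ⟦ ⋁ Δ ⟧ → Any (λ δ → w ∈ ⟦ δ ⟧) Δ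
      -- The empty disjunction is `¬ ⊤`, true at no world.
      ∈⟦⋁⟧⁻ []      w∈⊥ = contradiction ∈⟦⊤⟧ (∈⟦¬⟧⁻ ⊤ w∈⊥)
      ∈⟦⋁⟧⁻ (δ ∷ Δ) w∈⋁ = [ here , there ∘ ∈⟦⋁⟧⁻ Δ ]′ (∈⟦∨⟧⁻ δ (⋁ Δ) w∈⋁)

fact9 : ∀ {ℓ} → ExcludedMiddle ℓ →
    (α : Upset ℓ) (A : Argument) → MateriallyValid α A ⇔ ClassicallyValid ℓ A
fact9 em α (Γ ▷ Δ) = mk⇔
  (λ material M w w∈Γ → ∈⟦⋁⟧⁻ M em Δ
    (∈⟦⊃⟧⁻ M em (⋀ Γ) (⋁ Δ)
      -- In this model the probability of the conditional is the indicator of its truth at `w` in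
      -- `M`.
      (indicator∈upset⇒true α em (material (pointMass M em w)))
      (∈⟦⋀⟧⁺ M em w∈Γ)))
  (λ classical M → sure⇒Pr∈α M α (⋀ Γ ⊃ ⋁ Δ) λ w →
    ∈⟦⊃⟧⁺ M em (⋀ Γ) (⋁ Δ) (∈⟦⋁⟧⁺ M ∘ classical M w ∘ ∈⟦⋀⟧⁻ M em Γ))
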